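{- Let $A\in\mathcal{L}_\mu$. If $A$ is true in every admissible intuitionistic $\mu$-phase model, then $\vdash A$ is provable in $\mu\mathbf{IMALL}^-$, i.e. in $\mu\mathbf{IMALL}$ without the rule $(Cut)$.
   Context: Syntax. Let $\mathcal{V}$ (variables) and $\mathcal{A}$ (atomic formulas) be disjoint countably infinite sets. The set $\mathcal{L}_\mu$ of formulas is generated by $$A ::= x \mid a \mid \mathbf{1} \mid \top \mid \mathbf{0} \mid A\otimes A \mid A \mathbin{\&} A \mid A\oplus A \mid A\multimap A \mid \mu x.A \mid \nu x.A \qquad (x\in\mathcal{V},\ a\in\mathcal{A}),$$ where $\mu x$ and $\nu x$ bind $x$, and $\mu x.A$, $\nu x.A$ are formulas if and only if $x$ is positive in $A$. A free occurrence of $x$ in $A$ is positive (negative) if reaching it in $A$ traverses the antecedent (left-hand side) of $\multimap$ an even (odd) number of times; $x$ is positive (negative) in $A$ if all free occurrences of $x$ in $A$ are positive (negative). In particular a variable not occurring free in $A$ is both. Formulas may contain free variables, and $\alpha$-equivalent formulas are identified. $A(F/x)$ denotes capture-avoiding substitution of $F$ for the free occurrences of $x$ in $A$. Sequent calculus. A sequent $\Gamma\vdash C$ consists of a finite multiset $\Gamma$ of formulas and exactly one formula $C$; $\Gamma,\Delta$ denotes the multiset union (with multiplicities added), and $\vdash C$ means the antecedent is empty. A proof is a finite tree built from the following axioms and rules of $\mu\mathbf{IMALL}$ (premises $\Rightarrow$ conclusion), where $i\in\{0,1\}$: (id) $A\vdash A$; ($Cut$) $\Gamma\vdash A$ and $A,\Delta\vdash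 B$ $\Rightarrow$ $\Gamma,\Delta\vdash B$; ($\vdash\mathbf{1}$) $\vdash\mathbf{1}$; ($\mathbf{1}\vdash$) $\Gamma\vdash C$ $\Rightarrow$ $\mathbf{1},\Gamma\vdash C$; ($\vdash\top$) $\Gamma\vdash\top$; ($\mathbf{0}\vdash$) $\mathbf{0},\Gamma\vdash C$; ($\vdash\otimes$) $\Gamma\vdash A$ and $\Delta\vdash B$ $\Rightarrow$ $\Gamma,\Delta\vdash A\otimes B$; ($\otimes\vdash$) $A,B,\Gamma\vdash C$ $\Rightarrow$ $A\otimes B,\Gamma\vdash C$; ($\vdash\&$) $\Gamma\vdash A$ and $\Gamma\vdash B$ $\Rightarrow$ $\Gamma\vdash A\mathbin{\&}B$; ($\&\vdash$) $A_i,\Gamma\vdash C$ $\Rightarrow$ $A_0\mathbin{\&}A_1,\Gamma\vdash C$; ($\vdash\oplus$) $\Gamma\vdash A_i$ $\Rightarrow$ $\Gamma\vdash A_0\oplus A_1$; ($\oplus\vdash$) $A,\Gamma\vdash C$ and $B,\Gamma\vdash C$ $\Rightarrow$ $A\oplus B,\Gamma\vdash C$; ($\vdash\multimap$) $A,\Gamma\vdash B$ $\Rightarrow$ $\Gamma\vdash A\multimap B$; ($\multimap\vdash$) $\Gamma\vdash A$ and $B,\Delta\vdash C$ $\Rightarrow$ $A\multimap B,\Gamma,\Delta\vdash C$; ($\vdash\mu$) $\Gamma\vdash A(\mu x.A/x)$ $\Rightarrow$ $\Gamma\vdash\mu x.A$; ($\mu\vdash$) $A(S/x)\vdash S$ and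 $S,\Gamma\vdash C$ $\Rightarrow$ $\mu x.A,\Gamma\vdash C$ (any formula $S$); ($\vdash\nu$) $\Gamma\vdash S$ and $S\vdash A(S/x)$ $\Rightarrow$ $\Gamma\vdash\nu x.A$ (any formula $S$); ($\nu\vdash$) $A(\nu x.A/x),\Gamma\vdash C$ $\Rightarrow$ $\nu x.A,\Gamma\vdash C$. $\mu\mathbf{IMALL}^-$ is $\mu\mathbf{IMALL}$ without ($Cut$). Phase semantics. Let $(M,\cdot,1)$ be a commutative monoid; for $X,Y\subseteq M$ put $XY=X\cdot Y=\{xy\mid x\in X,\ y\in Y\}$ and $X\multimap Y=\{y\in M\mid xy\in Y\text{ for all }x\in X\}$. A set $D_M\subseteq\wp(M)$ is a set of closed sets if (1) $\bigcap D'\in D_M$ for every $D'\subseteq D_M$ (with $\bigcap\emptyset=M$), and (2) $X\multimap Y\in D_M$ for all $X\subseteq M$ and $Y\in D_M$. Then $(M,D_M)$ is an intuitionistic phase space, and $cl(X)=\bigcap\{Y\in D_M\mid X\subseteq Y\}$. An intuitionistic $\mu$-phase model is a quadruple $(M,D_M,\mathcal{D},V)$ where $(M,D_M)$ is an intuitionistic phase space, $\mathcal{D}\subseteq D_M$, and $V:\mathcal{V}\cup\mathcal{A}\to\mathcal{D}$ (a $\mathcal{D}$-valuation). The interpretation is: $[\![p]\!]^V=V(p)$ for $p\in\mathcal{V}\cup\mathcal{A}$; $[\![\mathbf{1}]\!]^V=cl(\{1\})$; $[\![\top]\!]^V=M$; $[\![\mathbf{0}]\!]^V=cl(\emptyset)$;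 $[\![A\otimes B]\!]^V=cl([\![A]\!]^V\cdot[\![B]\!]^V)$; $[\![A\mathbin{\&}B]\!]^V=[\![A]\!]^V\cap[\![B]\!]^V$; $[\![A\oplus B]\!]^V=cl([\![A]\!]^V\cup[\![B]\!]^V)$; $[\![A\multimap B]\!]^V=[\![A]\!]^V\multimap[\![B]\!]^V$; $$[\![\mu x.A]\!]^V=\bigcap\{X\in\mathcal{D}\mid[\![A]\!]^{V[x\mapsto X]}\subseteq X\},\qquad [\![\nu x.A]\!]^V=cl\Bigl(\bigcup\{X\in\mathcal{D}\mid X\subseteq[\![A]\!]^{V[x\mapsto X]}\}\Bigr),$$ where $V[x\mapsto X]$ agrees with $V$ except that it sends $x$ to $X$. The model (and $V$) is admissible if $[\![A]\!]^V\in\mathcal{D}$ for all $A\in\mathcal{L}_\mu$. A formula $A$ is true in the model if $1\in[\![A]\!]^V$. -}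

module Defs where

open import Algebra.Bundles using (CommutativeMonoid)
open import Axiom.ExcludedMiddle using (ExcludedMiddle)
open import Data.Empty using (⊥)
open import Data.List.Base using (List; []; _∷_; _++_; [_])
open import Data.List.Relation.Binary.Permutation.Propositional using (_↭_)
open import Data.Nat.Base using (ℕ; zero; suc)
open import Data.Nat.Properties using (suc-injective)
open import Data.Product.Base using (∃; _×_; _,_; ∃-syntax; ∃₂)
open import Data.Sign.Base using (Sign; opposite) renaming (+ to pos; - to neg)
open import Data.Sum.Base using (_⊎_; inj₁; inj₂)
open import Level using (0ℓ) renaming (suc to lsuc)
open import Relation.Binary.Definitions using (_Respects_)
open import Relation.Binary.PropositionalEquality.Core using (_≡_; refl)
open import Relation.Nullary.Decidable.Core using (True)
open import Relation.Unary using (Pred; _∈_; _⊆_; _≐_; _∩_; _∪_; U; ∅)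

------------------------------------------------------------------------
-- Formulas

-- Variables and atoms are two separate copies of ℕ.  Formulas are in
-- de Bruijn style, so that α-equivalent formulas are equal: under k
-- binders, index i < k is a bound variable and index k + i is the free
-- variable number i.
--
-- `Occurs s x A` says that x has a free occurrence of sign s in A.  The
-- positivity side condition of μ and ν is part of the syntax (hence the
-- induction-recursion); it is irrelevant, so that it does not affect
-- equality of formulas.

infixr 9 _⊗_ _&_ _⊕_
infixr 8 _⊸_

data Formula : Set
Occurs   : Sign → ℕ → Formula → Set
Positive : ℕ → Formula → Set

data Formula where
  var         : ℕ → Formula
  atom        : ℕ → Formula
  𝟏 ⊤ 𝟎       : Formula
  _⊗_ _&_ _⊕_ : Formula → Formula → Formula
  _⊸_         : Formula → Formula → Formula
  μ ν         : (A : Formula) → .(Positive 0 A) → Formula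

Occurs s x (var y)  = (s ≡ pos) × (x ≡ y)
Occurs s x (atom a) = ⊥
Occurs s x 𝟏        = ⊥
Occurs s x ⊤        = ⊥
Occurs s x 𝟎        = ⊥
Occurs s x (A ⊗ B)  = Occurs s x A ⊎ Occurs s x B
Occurs s x (A & B)  = Occurs s x A ⊎ Occurs s x B
Occurs s x (A ⊕ B)  = Occurs s x A ⊎ Occurs s x B
Occurs s x (A ⊸ B)  = Occurs (opposite s) x A ⊎ Occurs s x B
Occurs s x (μ A _)  = Occurs s (suc x) A
Occurs s x (ν A _)  = Occurs s (suc x) A

Positive x A = ∀ s → Occurs s x A → s ≡ pos

------------------------------------------------------------------------
-- Renaming and substitution, which preserve the positivity of bound
-- variables

ext : (ℕ → ℕ) → ℕ → ℕ
ext ρ zero    = zero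
ext ρ (suc x) = suc (ρ x)

rename : (ℕ → ℕ) → Formula → Formula

occurs-rename : ∀ ρ A {s x} → Occurs s x (rename ρ A) →
                ∃[ y ] Occurs s y A × x ≡ ρ y

positive-ext : ∀ ρ A → Positive 0 A → Positive 0 (rename (ext ρ) A)

rename ρ (var x)  = var (ρ x)
rename ρ (atom a) = atom a
rename ρ 𝟏        = 𝟏
rename ρ ⊤        = ⊤
rename ρ 𝟎        = 𝟎
rename ρ (A ⊗ B)  = rename ρ A ⊗ rename ρ B
rename ρ (A & B)  = rename ρ A & rename ρ B
rename ρ (A ⊕ B)  = rename ρ A ⊕ rename ρ B
rename ρ (A ⊸ B)  = rename ρ A ⊸ rename ρ B
rename ρ (μ A p)  = μ (rename (ext ρ) A) (positive-ext ρ A p)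
rename ρ (ν A p)  = ν (rename (ext ρ) A) (positive-ext ρ A p)

private
  -- The proof components shared by all binary connectives.
  rename-⊎ : ∀ {P Q : Set} {P′ Q′ : ℕ → Set} {x : ℕ} (ρ : ℕ → ℕ) →
             (P → ∃[ y ] P′ y × x ≡ ρ y) → (Q → ∃[ y ] Q′ y × x ≡ ρ y) →
             P ⊎ Q → ∃[ y ] (P′ y ⊎ Q′ y) × x ≡ ρ y
  rename-⊎ ρ f g (inj₁ o) with y , o′ , e ← f o = y , inj₁ o′ , e
  rename-⊎ ρ f g (inj₂ o) with y , o′ , e ← g o = y , inj₂ o′ , e

  rename-binder : ∀ {P : ℕ → Set} {x : ℕ} (ρ : ℕ → ℕ) →
                  ∃[ y ] P y × suc x ≡ ext ρ y →
                  ∃[ y ] P (suc y) × x ≡ ρ y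
  rename-binder ρ (zero  , o , ())
  rename-binder ρ (suc y , o , e) = y , o , suc-injective e

occurs-rename ρ (var y) (s≡ , x≡) = y , (s≡ , refl) , x≡
occurs-rename ρ (A ⊗ B) = rename-⊎ ρ (occurs-rename ρ A) (occurs-rename ρ B)
occurs-rename ρ (A & B) = rename-⊎ ρ (occurs-rename ρ A) (occurs-rename ρ B)
occurs-rename ρ (A ⊕ B) = rename-⊎ ρ (occurs-rename ρ A) (occurs-rename ρ B)
occurs-rename ρ (A ⊸ B) = rename-⊎ ρ (occurs-rename ρ A) (occurs-rename ρ B)
occurs-rename ρ (μ A _) o = rename-binder ρ (occurs-rename (ext ρ) A o)
occurs-rename ρ (ν A _) o = rename-binder ρ (occurs-rename (ext ρ) A o)

positive-ext ρ A p s o with occurs-rename (ext ρ) A o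
... | zero  , o′ , _  = p s o′
... | suc y , o′ , ()

exts : (ℕ → Formula) → ℕ → Formula
exts σ zero    = var zero
exts σ (suc x) = rename suc (σ x)

subst : (ℕ → Formula) → Formula → Formula

-- Signs of occurrences multiply, but for positivity it is enough to
-- know in which σ y an occurrence lies, and that its sign is inherited
-- from A whenever σ y is a variable.
occurs-subst : ∀ σ A {s x} → Occurs s x (subst σ A) →
               ∃[ y ] ∃[ t ] Occurs t x (σ y) ×
                 (∀ z → σ y ≡ var z → Occurs s y A)

positive-exts : ∀ σ A → Positive 0 A → Positive 0 (subst (exts σ) A)

subst σ (var x)  = σ x
subst σ (atom a) = atom a
subst σ 𝟏        = 𝟏
subst σ ⊤        = ⊤
subst σ 𝟎        = 𝟎
subst σ (A ⊗ B)  = subst σ A ⊗ subst σ B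
subst σ (A & B)  = subst σ A & subst σ B
subst σ (A ⊕ B)  = subst σ A ⊕ subst σ B
subst σ (A ⊸ B)  = subst σ A ⊸ subst σ B
subst σ (μ A p)  = μ (subst (exts σ) A) (positive-exts σ A p)
subst σ (ν A p)  = ν (subst (exts σ) A) (positive-exts σ A p)

private
  Origin : (ℕ → Formula) → (ℕ → Set) → ℕ → Set
  Origin σ P x =
    ∃[ y ] ∃[ t ] Occurs t x (σ y) × (∀ z → σ y ≡ var z → P y)

  subst-⊎ : ∀ {P Q : Set} {P′ Q′ : ℕ → Set} {x : ℕ} (σ : ℕ → Formula) →
            (P → Origin σ P′ x) → (Q → Origin σ Q′ x) →
            P ⊎ Q → Origin σ (λ y → P′ y ⊎ Q′ y) x
  subst-⊎ σ f g (inj₁ o) with y , t , o′ , h ← f o =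
    y , t , o′ , λ z e → inj₁ (h z e)
  subst-⊎ σ f g (inj₂ o) with y , t , o′ , h ← g o =
    y , t , o′ , λ z e → inj₂ (h z e)

  subst-binder : ∀ {P : ℕ → Set} {x : ℕ} (σ : ℕ → Formula) →
                 Origin (exts σ) P (suc x) → Origin σ (λ y → P (suc y)) x
  subst-binder σ (zero  , t , (_ , ()) , h)
  subst-binder σ (suc y , t , o , h) with occurs-rename suc (σ y) o
  ... | z , o′ , refl = y , t , o′ , λ { w e → h (suc w) (lemma e) }
    where
    lemma : ∀ {w B} → B ≡ var w → rename suc B ≡ var (suc w)
    lemma refl = refl

occurs-subst σ (var y) {s} o = y , s , o , λ z e → sign e o , refl
  where
  sign : ∀ {B z s x} → B ≡ var z → Occurs s x B → s ≡ pos
  sign refl (s≡ , _) = s≡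
occurs-subst σ (A ⊗ B) = subst-⊎ σ (occurs-subst σ A) (occurs-subst σ B)
occurs-subst σ (A & B) = subst-⊎ σ (occurs-subst σ A) (occurs-subst σ B)
occurs-subst σ (A ⊕ B) = subst-⊎ σ (occurs-subst σ A) (occurs-subst σ B)
occurs-subst σ (A ⊸ B) = subst-⊎ σ (occurs-subst σ A) (occurs-subst σ B)
occurs-subst σ (μ A _) o = subst-binder σ (occurs-subst (exts σ) A o)
occurs-subst σ (ν A _) o = subst-binder σ (occurs-subst (exts σ) A o)

positive-exts σ A p s o with occurs-subst (exts σ) A o
... | zero  , t , o′ , h = p s (h 0 refl)
... | suc y , t , o′ , h with occurs-rename suc (σ y) o′
...   | _ , _ , ()

infixr 6 _•_

_•_ : ∀ {ℓ} {X : Set ℓ} → X → (ℕ → X) → ℕ → X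
(a • f) zero    = a
(a • f) (suc x) = f x

-- A(F/x) where x is the variable with index 0.
infix 10 _⟨_⟩

_⟨_⟩ : Formula → Formula → Formula
A ⟨ F ⟩ = subst (F • var) A

------------------------------------------------------------------------
-- Sequent calculus

data System : Set where
  μIMALL μIMALL⁻ : System

-- Antecedents are finite multisets, represented by lists together with
-- the rule `exchange`, which identifies lists that are permutations of
-- each other.

infix 4 _∣_⊢_

data _∣_⊢_ (𝒮 : System) : List Formula → Formula → Set where
  exchange : ∀ {Γ Δ C} → Γ ↭ Δ → 𝒮 ∣ Γ ⊢ C → 𝒮 ∣ Δ ⊢ C
  id  : ∀ {A} → 𝒮 ∣ [ A ] ⊢ A
  cut : ∀ {Γ Δ A B} → 𝒮 ≡ μIMALL →
        𝒮 ∣ Γ ⊢ A → 𝒮 ∣ A ∷ Δ ⊢ B → 𝒮 ∣ Γ ++ Δ ⊢ B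
  ⊢𝟏  : 𝒮 ∣ [] ⊢ 𝟏
  𝟏⊢  : ∀ {Γ C} → 𝒮 ∣ Γ ⊢ C → 𝒮 ∣ 𝟏 ∷ Γ ⊢ C
  ⊢⊤  : ∀ {Γ} → 𝒮 ∣ Γ ⊢ ⊤
  𝟎⊢  : ∀ {Γ C} → 𝒮 ∣ 𝟎 ∷ Γ ⊢ C
  ⊢⊗  : ∀ {Γ Δ A B} → 𝒮 ∣ Γ ⊢ A → 𝒮 ∣ Δ ⊢ B → 𝒮 ∣ Γ ++ Δ ⊢ A ⊗ B
  ⊗⊢  : ∀ {Γ A B C} → 𝒮 ∣ A ∷ B ∷ Γ ⊢ C → 𝒮 ∣ A ⊗ B ∷ Γ ⊢ C
  ⊢&  : ∀ {Γ A B} → 𝒮 ∣ Γ ⊢ A → 𝒮 ∣ Γ ⊢ B → 𝒮 ∣ Γ ⊢ A & B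
  &⊢₀ : ∀ {Γ A B C} → 𝒮 ∣ A ∷ Γ ⊢ C → 𝒮 ∣ A & B ∷ Γ ⊢ C
  &⊢₁ : ∀ {Γ A B C} → 𝒮 ∣ B ∷ Γ ⊢ C → 𝒮 ∣ A & B ∷ Γ ⊢ C
  ⊢⊕₀ : ∀ {Γ A B} → 𝒮 ∣ Γ ⊢ A → 𝒮 ∣ Γ ⊢ A ⊕ B
  ⊢⊕₁ : ∀ {Γ A B} → 𝒮 ∣ Γ ⊢ B → 𝒮 ∣ Γ ⊢ A ⊕ B
  ⊕⊢  : ∀ {Γ A B C} → 𝒮 ∣ A ∷ Γ ⊢ C → 𝒮 ∣ B ∷ Γ ⊢ C →
        𝒮 ∣ A ⊕ B ∷ Γ ⊢ C
  ⊢⊸  : ∀ {Γ A B} → 𝒮 ∣ A ∷ Γ ⊢ B → 𝒮 ∣ Γ ⊢ A ⊸ B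
  ⊸⊢  : ∀ {Γ Δ A B C} → 𝒮 ∣ Γ ⊢ A → 𝒮 ∣ B ∷ Δ ⊢ C →
        𝒮 ∣ A ⊸ B ∷ Γ ++ Δ ⊢ C
  ⊢μ  : ∀ {Γ A} .{p : Positive 0 A} →
        𝒮 ∣ Γ ⊢ A ⟨ μ A p ⟩ → 𝒮 ∣ Γ ⊢ μ A p
  μ⊢  : ∀ {Γ A C} .{p : Positive 0 A} (S : Formula) →
        𝒮 ∣ [ A ⟨ S ⟩ ] ⊢ S → 𝒮 ∣ S ∷ Γ ⊢ C → 𝒮 ∣ μ A p ∷ Γ ⊢ C
  ⊢ν  : ∀ {Γ A} .{p : Positive 0 A} (S : Formula) →
        𝒮 ∣ Γ ⊢ S → 𝒮 ∣ [ S ] ⊢ A ⟨ S ⟩ → 𝒮 ∣ Γ ⊢ ν A p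
  ν⊢  : ∀ {Γ A C} .{p : Positive 0 A} →
        𝒮 ∣ A ⟨ ν A p ⟩ ∷ Γ ⊢ C → 𝒮 ∣ ν A p ∷ Γ ⊢ C

------------------------------------------------------------------------
-- Phase semantics

-- The metatheory of the semantics is classical and impredicative: ⋂ and
-- ⋃ of a set of subsets of M must again be subsets of M.  In a
-- predicative theory the defining quantification over Pred M 0ℓ lives
-- one universe too high; excluded middle brings it back down, since a
-- decided proposition P is equivalent to the small type True (em {P}).

module Resizing (em : ExcludedMiddle (lsuc 0ℓ)) where

  ⋂ : {M : Set} → Pred (Pred M 0ℓ) (lsuc 0ℓ) → Pred M 0ℓ
  ⋂ 𝒳 m = True (em {∀ X → X ∈ 𝒳 → m ∈ X})

  ⋃ : {M : Set} → Pred (Pred M 0ℓ) (lsuc 0ℓ) → Pred M 0ℓ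
  ⋃ 𝒳 m = True (em {∃[ X ] X ∈ 𝒳 × m ∈ X})

module MonoidSubsets (M : CommutativeMonoid 0ℓ 0ℓ) where
  open CommutativeMonoid M

  infixl 7 _·_
  infixr 6 _⇒_

  _·_ : Pred Carrier 0ℓ → Pred Carrier 0ℓ → Pred Carrier 0ℓ
  (X · Y) z = ∃₂ λ x y → x ∈ X × y ∈ Y × z ≈ x ∙ y

  -- The set X ⊸ Y.
  _⇒_ : Pred Carrier 0ℓ → Pred Carrier 0ℓ → Pred Carrier 0ℓ
  (X ⇒ Y) y = ∀ {x} → x ∈ X → x ∙ y ∈ Y

  ｛1｝ : Pred Carrier 0ℓ
  ｛1｝ = _≈ ε

-- The monoid is a setoid, and equality of subsets is ≐; the fields
-- `resp-≈` and `resp-≐` say that closed sets are subsets of the quotient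
-- of the carrier by ≈, and that Closed is a set of such subsets.

record PhaseSpace (em : ExcludedMiddle (lsuc 0ℓ)) : Set₂ where
  open Resizing em
  field
    monoid : CommutativeMonoid 0ℓ 0ℓ
  open CommutativeMonoid monoid public
    using (Carrier; _≈_; _∙_; ε)
  open MonoidSubsets monoid public
  field
    Closed   : Pred (Pred Carrier 0ℓ) (lsuc 0ℓ)
    resp-≈   : ∀ {X} → X ∈ Closed → X Respects _≈_
    resp-≐   : Closed Respects _≐_
    ⋂-closed : ∀ (𝒳 : Pred (Pred Carrier 0ℓ) (lsuc 0ℓ)) →
               𝒳 ⊆ Closed → ⋂ 𝒳 ∈ Closed
    ⇒-closed : ∀ X Y → Y ∈ Closed → X ⇒ Y ∈ Closed

  cl : Pred Carrier 0ℓ → Pred Carrier 0ℓ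
  cl X = ⋂ λ Y → Y ∈ Closed × X ⊆ Y

record PhaseModel (em : ExcludedMiddle (lsuc 0ℓ)) : Set₂ where
  open Resizing em
  field
    space : PhaseSpace em
  open PhaseSpace space public
  field
    𝒟        : Pred (Pred Carrier 0ℓ) (lsuc 0ℓ)
    𝒟-resp-≐ : 𝒟 Respects _≐_
    𝒟⊆Closed : 𝒟 ⊆ Closed
    -- The restrictions of the valuation to variables and to atoms.
    V   : ℕ → Pred Carrier 0ℓ
    V∈𝒟 : ∀ x → V x ∈ 𝒟
    W   : ℕ → Pred Carrier 0ℓ
    W∈𝒟 : ∀ a → W a ∈ 𝒟

  -- In de Bruijn style, X • v is the valuation v[x ↦ X] for the variable
  -- x bound by μ or ν.
  ⟦_⟧ : Formula → (ℕ → Pred Carrier 0ℓ) → Pred Carrier 0ℓ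
  ⟦ var x  ⟧ v = v x
  ⟦ atom a ⟧ v = W a
  ⟦ 𝟏      ⟧ v = cl ｛1｝
  ⟦ ⊤      ⟧ v = U
  ⟦ 𝟎      ⟧ v = cl ∅
  ⟦ A ⊗ B  ⟧ v = cl (⟦ A ⟧ v · ⟦ B ⟧ v)
  ⟦ A & B  ⟧ v = ⟦ A ⟧ v ∩ ⟦ B ⟧ v
  ⟦ A ⊕ B  ⟧ v = cl (⟦ A ⟧ v ∪ ⟦ B ⟧ v)
  ⟦ A ⊸ B  ⟧ v = ⟦ A ⟧ v ⇒ ⟦ B ⟧ v
  ⟦ μ A _  ⟧ v = ⋂ λ X → X ∈ 𝒟 × ⟦ A ⟧ (X • v) ⊆ X
  ⟦ ν A _  ⟧ v = cl (⋃ λ X → X ∈ 𝒟 × X ⊆ ⟦ A ⟧ (X • v))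

  Admissible : Set₁
  Admissible = ∀ A → ⟦ A ⟧ V ∈ 𝒟

  IsTrue : Formula → Set
  IsTrue A = ε ∈ ⟦ A ⟧ V

{-# OPTIONS --safe #-}

-- The syntactic model has as points the finite multisets of formulas and
-- as closed sets the intersections of sets {Γ | Γ, Δ ⊢ C cut-free}.  Let
-- 𝒟 consist of the closed sets X for which some formula F satisfies
-- F ∈ X ⊆ {Γ | Γ ⊢ F}.  Such candidates are stable under all connectives:
-- for μ and ν, the premises S of the (co)induction rules are exactly the
-- formulas that witness membership in 𝒟, while unfolding is handled by the
-- largest candidate {Γ | Γ ⊢ μ A} for μ and by the least one, cl {ν A},
-- for ν.  Hence the model is admissible, and 1 ∈ ⟦A⟧ means ⊢ A.

module Submission where

open import Defs
open import Axiom.ExcludedMiddle using (ExcludedMiddle)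
open import Data.List.Base using (List; []; _∷_; _++_; [_])
open import Data.List.Properties using (++-assoc; ++-identityʳ)
open import Data.List.Relation.Binary.Permutation.Propositional
  using (_↭_; ↭-refl; ↭-sym; ↭-trans; ↭-reflexive)
open import Data.List.Relation.Binary.Permutation.Propositional.Properties
  using (++⁺ʳ; ++-commutativeMonoid; shift; shifts)
open import Data.Nat.Base using (zero; suc)
open import Data.Product.Base using (_,_; ∃-syntax; proj₁; proj₂)
open import Data.Sum.Base using (inj₁; inj₂)
open import Data.Unit.Base using (tt)
open import Function.Base using (_∘_)
open import Level using (0ℓ; Lift; lift; lower) renaming (suc to lsuc)
open import Relation.Binary.PropositionalEquality.Core as ≡
  using (_≡_; refl; sym; trans; cong; cong₂; _≗_)
open import Relation.Nullary.Decidable.Core using (toWitness; fromWitness)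
open import Relation.Unary using (Pred; _∈_; _⊆_)

-- Substitution

private
  -- Positivity proofs are irrelevant arguments, so `refl` also identifies formulas that carry
  -- unrelated ones.
  μ-cong : ∀ {A B} .{p : Positive 0 A} .{q : Positive 0 B} →
           A ≡ B → μ A p ≡ μ B q
  μ-cong refl = refl

  ν-cong : ∀ {A B} .{p : Positive 0 A} .{q : Positive 0 B} →
           A ≡ B → ν A p ≡ ν B q
  ν-cong refl = refl

exts-var : ∀ {σ} → σ ≗ var → exts σ ≗ var
exts-var e zero    = refl
exts-var e (suc x) = cong (rename suc) (e x)

-- The hypothesis uses `≗`, here and in the fusion laws below, because under a binder the extended
-- maps agree only pointwise.
subst-var : ∀ {σ} → σ ≗ var → ∀ A → subst σ A ≡ A
subst-var e (var x)  = e x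
subst-var e (atom a) = refl
subst-var e 𝟏        = refl
subst-var e ⊤        = refl
subst-var e 𝟎        = refl
subst-var e (A ⊗ B)  = cong₂ _⊗_ (subst-var e A) (subst-var e B)
subst-var e (A & B)  = cong₂ _&_ (subst-var e A) (subst-var e B)
subst-var e (A ⊕ B)  = cong₂ _⊕_ (subst-var e A) (subst-var e B)
subst-var e (A ⊸ B)  = cong₂ _⊸_ (subst-var e A) (subst-var e B)
subst-var e (μ A _)  = μ-cong (subst-var (exts-var e) A)
subst-var e (ν A _)  = ν-cong (subst-var (exts-var e) A)

ext-∘ : ∀ {ρ₁ ρ₂ ρ} → ρ₂ ∘ ρ₁ ≗ ρ → ext ρ₂ ∘ ext ρ₁ ≗ ext ρ
ext-∘ e zero    = refl
ext-∘ e (suc x) = cong suc (e x)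

rename-rename : ∀ {ρ₁ ρ₂ ρ} → ρ₂ ∘ ρ₁ ≗ ρ →
                ∀ A → rename ρ₂ (rename ρ₁ A) ≡ rename ρ A
rename-rename e (var x)  = cong var (e x)
rename-rename e (atom a) = refl
rename-rename e 𝟏        = refl
rename-rename e ⊤        = refl
rename-rename e 𝟎        = refl
rename-rename e (A ⊗ B)  = cong₂ _⊗_ (rename-rename e A) (rename-rename e B)
rename-rename e (A & B)  = cong₂ _&_ (rename-rename e A) (rename-rename e B)
rename-rename e (A ⊕ B)  = cong₂ _⊕_ (rename-rename e A) (rename-rename e B)
rename-rename e (A ⊸ B)  = cong₂ _⊸_ (rename-rename e A) (rename-rename e B)
rename-rename e (μ A _)  = μ-cong (rename-rename (ext-∘ e) A)
rename-rename e (ν A _)  = ν-cong (rename-rename (ext-∘ e) A)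

exts-∘-ext : ∀ {ρ σ τ} → σ ∘ ρ ≗ τ → exts σ ∘ ext ρ ≗ exts τ
exts-∘-ext e zero    = refl
exts-∘-ext e (suc x) = cong (rename suc) (e x)

subst-rename : ∀ {ρ σ τ} → σ ∘ ρ ≗ τ →
               ∀ A → subst σ (rename ρ A) ≡ subst τ A
subst-rename e (var x)  = e x
subst-rename e (atom a) = refl
subst-rename e 𝟏        = refl
subst-rename e ⊤        = refl
subst-rename e 𝟎        = refl
subst-rename e (A ⊗ B)  = cong₂ _⊗_ (subst-rename e A) (subst-rename e B)
subst-rename e (A & B)  = cong₂ _&_ (subst-rename e A) (subst-rename e B)
subst-rename e (A ⊕ B)  = cong₂ _⊕_ (subst-rename e A) (subst-rename e B)
subst-rename e (A ⊸ B)  = cong₂ _⊸_ (subst-rename e A) (subst-rename e B)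
subst-rename e (μ A _)  = μ-cong (subst-rename (exts-∘-ext e) A)
subst-rename e (ν A _)  = ν-cong (subst-rename (exts-∘-ext e) A)

rename-ext-∘-exts : ∀ {ρ σ τ} → rename ρ ∘ σ ≗ τ →
                    rename (ext ρ) ∘ exts σ ≗ exts τ
rename-ext-∘-exts e zero = refl
rename-ext-∘-exts {ρ} {σ} e (suc x) =
  -- `ext ρ` after `suc` and `suc` after `ρ` are the same renaming of `σ x`.
  trans (rename-rename (λ _ → refl) (σ x))
        (trans (sym (rename-rename (λ _ → refl) (σ x)))
               (cong (rename suc) (e x)))

rename-subst : ∀ {ρ σ τ} → rename ρ ∘ σ ≗ τ →
               ∀ A → rename ρ (subst σ A) ≡ subst τ A
rename-subst e (var x)  = e x
rename-subst e (atom a) = refl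
rename-subst e 𝟏        = refl
rename-subst e ⊤        = refl
rename-subst e 𝟎        = refl
rename-subst e (A ⊗ B)  = cong₂ _⊗_ (rename-subst e A) (rename-subst e B)
rename-subst e (A & B)  = cong₂ _&_ (rename-subst e A) (rename-subst e B)
rename-subst e (A ⊕ B)  = cong₂ _⊕_ (rename-subst e A) (rename-subst e B)
rename-subst e (A ⊸ B)  = cong₂ _⊸_ (rename-subst e A) (rename-subst e B)
rename-subst e (μ A _)  = μ-cong (rename-subst (rename-ext-∘-exts e) A)
rename-subst e (ν A _)  = ν-cong (rename-subst (rename-ext-∘-exts e) A)

subst-exts-∘-exts : ∀ {σ₁ σ₂ τ} → subst σ₂ ∘ σ₁ ≗ τ →
                    subst (exts σ₂) ∘ exts σ₁ ≗ exts τ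
subst-exts-∘-exts e zero = refl
subst-exts-∘-exts {σ₁} e (suc x) =
  trans (subst-rename (λ _ → refl) (σ₁ x))
        (trans (sym (rename-subst (λ _ → refl) (σ₁ x)))
               (cong (rename suc) (e x)))

subst-subst : ∀ {σ₁ σ₂ τ} → subst σ₂ ∘ σ₁ ≗ τ →
              ∀ A → subst σ₂ (subst σ₁ A) ≡ subst τ A
subst-subst e (var x)  = e x
subst-subst e (atom a) = refl
subst-subst e 𝟏        = refl
subst-subst e ⊤        = refl
subst-subst e 𝟎        = refl
subst-subst e (A ⊗ B)  = cong₂ _⊗_ (subst-subst e A) (subst-subst e B)
subst-subst e (A & B)  = cong₂ _&_ (subst-subst e A) (subst-subst e B)
subst-subst e (A ⊕ B)  = cong₂ _⊕_ (subst-subst e A) (subst-subst e B)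
subst-subst e (A ⊸ B)  = cong₂ _⊸_ (subst-subst e A) (subst-subst e B)
subst-subst e (μ A _)  = μ-cong (subst-subst (subst-exts-∘-exts e) A)
subst-subst e (ν A _)  = ν-cong (subst-subst (subst-exts-∘-exts e) A)

-- The rules for `μ` and `ν` instantiate the body after `exts σ`, whereas the semantic induction
-- sends the bound variable to `S` through `S • σ`. Shifting `σ x` by `suc` is undone by the
-- instantiation.
subst-exts-⟨⟩ : ∀ σ S A → subst (exts σ) A ⟨ S ⟩ ≡ subst (S • σ) A
subst-exts-⟨⟩ σ S = subst-subst λ
  { zero    → refl
  ; (suc x) → trans (subst-rename {τ = var} (λ _ → refl) (σ x))
                    (subst-var (λ _ → refl) (σ x))
  }

-- The syntactic model

infix 4 _⊢_

_⊢_ : List Formula → Formula → Set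
Γ ⊢ C = μIMALL⁻ ∣ Γ ⊢ C

-- Closed sets of contexts and candidates.

Provers : Formula → Pred (List Formula) 0ℓ
Provers F Γ = Γ ⊢ F

-- The intersection of all sets {Γ | Γ, Δ ⊢ C} that include X.
Closure : Pred (List Formula) 0ℓ → Pred (List Formula) 0ℓ
Closure X Γ = ∀ Δ C → (∀ {Γ′} → Γ′ ∈ X → Γ′ ++ Δ ⊢ C) → Γ ++ Δ ⊢ C

IsClosed : Pred (List Formula) 0ℓ → Set
IsClosed X = Closure X ⊆ X

Closure-extensive : ∀ {X} → X ⊆ Closure X
Closure-extensive Γ∈X Δ C h = h Γ∈X

Closure-isClosed : ∀ X → IsClosed (Closure X)
Closure-isClosed X Γ∈ Δ C h = Γ∈ Δ C λ Γ′∈ → Γ′∈ Δ C h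

Closure-mono : ∀ {X Y} → X ⊆ Y → Closure X ⊆ Closure Y
Closure-mono X⊆Y Γ∈ Δ C h = Γ∈ Δ C λ Γ′∈X → h (X⊆Y Γ′∈X)

Provers-closed : ∀ F → IsClosed (Provers F)
Provers-closed F {Γ} Γ∈ = ≡.subst (_⊢ F) (++-identityʳ Γ)
  (Γ∈ [] F λ {Γ′} → ≡.subst (_⊢ F) (sym (++-identityʳ Γ′)))

isClosed-resp-↭ : ∀ {X} → IsClosed X → ∀ {Γ Δ} → Γ ↭ Δ → Γ ∈ X → Δ ∈ X
isClosed-resp-↭ X-closed Γ↭Δ Γ∈X =
  X-closed λ Θ C h → exchange (++⁺ʳ Θ Γ↭Δ) (h Γ∈X)

-- By closedness, `member` amounts to `Closure (_≡ [ F ]) ⊆ X`, so the candidates for `F` form an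
-- interval whose endpoints are treated next. That the endpoints coincide would be precisely cut on
-- `F`.
record Candidate (F : Formula) (X : Pred (List Formula) 0ℓ) : Set where
  constructor candidate
  field
    closed : IsClosed X
    member : [ F ] ∈ X
    proves : X ⊆ Provers F

open Candidate

Provers-candidate : ∀ F → Candidate F (Provers F)
Provers-candidate F = candidate (Provers-closed F) id λ Γ⊢F → Γ⊢F

Closure-candidate : ∀ F → Candidate F (Closure (_≡ [ F ]))
Closure-candidate F = candidate
  (Closure-isClosed _)
  (Closure-extensive refl)
  (λ Γ∈ → Provers-closed F (Closure-mono (λ { refl → id }) Γ∈))

•-candidate : ∀ {S X σ v} → Candidate S X → (∀ x → Candidate (σ x) (v x)) →
              ∀ x → Candidate ((S • σ) x) ((X • v) x)
•-candidate c cs zero    = c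
•-candidate c cs (suc x) = cs x

-- The phase model of contexts and its admissibility.

module Syntactic (em : ExcludedMiddle (lsuc 0ℓ)) where
  open Resizing em

  space : PhaseSpace em
  space = record
    { monoid   = ++-commutativeMonoid
    -- `IsClosed` quantifies only over contexts and formulas, hence is small; `Lift` adjusts the
    -- level.
    ; Closed   = λ X → Lift (lsuc 0ℓ) (IsClosed X)
    ; resp-≈   = λ X-closed → isClosed-resp-↭ (lower X-closed)
    ; resp-≐   = λ (X⊆Y , Y⊆X) (lift X-closed) →
        lift λ {Γ} Γ∈ → X⊆Y (X-closed (Closure-mono Y⊆X {Γ} Γ∈))
    ; ⋂-closed = λ 𝒳 𝒳⊆Closed → lift λ {Γ} Γ∈ →
        fromWitness {a? = em} λ X X∈𝒳 → lower (𝒳⊆Closed X∈𝒳)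
          (Closure-mono (λ ⋂∋ → toWitness {a? = em} ⋂∋ X X∈𝒳) {Γ} Γ∈)
    ; ⇒-closed = λ X Y (lift Y-closed) → lift λ {Γ} Γ∈ {Θ} Θ∈X →
        -- Testing `Θ ++ Γ` against `Δ` becomes testing `Γ` against `Θ ++ Δ`; this is why `Closure`
        -- ranges over all side contexts.
        Y-closed λ Δ C h → exchange (swap Γ Θ Δ)
          (Γ∈ (Θ ++ Δ) C λ {Γ′} Γ′∈ → exchange (↭-sym (swap Γ′ Θ Δ)) (h (Γ′∈ Θ∈X)))
    }
    where
    swap : ∀ Γ Θ Δ → Γ ++ Θ ++ Δ ↭ (Θ ++ Γ) ++ Δ
    swap Γ Θ Δ = ↭-trans (shifts Γ Θ) (↭-reflexive (sym (++-assoc Θ Γ Δ)))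

  open PhaseSpace space using (cl; ⋂-closed; ⇒-closed)

  cl-extensive : ∀ {X} → X ⊆ cl X
  cl-extensive Γ∈X = fromWitness {a? = em} λ Y (_ , X⊆Y) → X⊆Y Γ∈X

  cl-least : ∀ {X Y} → IsClosed Y → X ⊆ Y → cl X ⊆ Y
  cl-least Y-closed X⊆Y Γ∈ = toWitness {a? = em} Γ∈ _ (lift Y-closed , X⊆Y)

  ⋃-least : ∀ {𝒳} {Y : Pred (List Formula) 0ℓ} →
            (∀ X → X ∈ 𝒳 → X ⊆ Y) → ⋃ 𝒳 ⊆ Y
  ⋃-least 𝒳⊆Y Γ∈ = let X , X∈𝒳 , Γ∈X = toWitness {a? = em} Γ∈ in 𝒳⊆Y X X∈𝒳 Γ∈X

  cl-closed : ∀ X → IsClosed (cl X)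
  cl-closed X = lower (⋂-closed _ proj₁)

  model : PhaseModel em
  model = record
    { space    = space
    ; 𝒟        = λ X → Lift (lsuc 0ℓ) (∃[ F ] Candidate F X)
    ; 𝒟-resp-≐ = λ (X⊆Y , Y⊆X) (lift (F , c)) → lift (F , candidate
        (lower (PhaseSpace.resp-≐ space (X⊆Y , Y⊆X) (lift (closed c))))
        (X⊆Y (member c))
        (proves c ∘ Y⊆X))
    ; 𝒟⊆Closed = λ (lift (_ , c)) → lift (closed c)
    ; V        = λ x → Provers (var x)
    ; V∈𝒟      = λ x → lift (var x , Provers-candidate (var x))
    ; W        = λ a → Provers (atom a)
    ; W∈𝒟      = λ a → lift (atom a , Provers-candidate (atom a))
    }

  open PhaseModel model using (⟦_⟧; V; Admissible)

  -- The induction is on `A` with `σ` and `v` general: under a binder, `σ` records the formula that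
  -- witnesses the set assigned to the variable. Left rules yield `member`, closedness supplying
  -- their side context and conclusion; right rules yield `proves`.
  ⟦⟧-candidate : ∀ A {σ v} → (∀ x → Candidate (σ x) (v x)) →
                 Candidate (subst σ A) (⟦ A ⟧ v)
  ⟦⟧-candidate (var x)  cs = cs x
  ⟦⟧-candidate (atom a) cs = Provers-candidate (atom a)
  ⟦⟧-candidate 𝟏 cs = candidate
    (cl-closed _)
    (cl-closed _ λ _ _ h → 𝟏⊢ (h (cl-extensive ↭-refl)))
    (cl-least (Provers-closed 𝟏) λ Γ↭[] → exchange (↭-sym Γ↭[]) ⊢𝟏)
  ⟦⟧-candidate ⊤ cs = candidate (λ _ → tt) tt (λ _ → ⊢⊤)
  ⟦⟧-candidate 𝟎 cs = candidate
    (cl-closed _)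
    (cl-closed _ λ _ _ _ → 𝟎⊢)
    (cl-least (Provers-closed 𝟎) λ ())
  ⟦⟧-candidate (A ⊗ B) cs = candidate
    (cl-closed _)
    (cl-closed _ λ _ _ h →
      ⊗⊢ (h (cl-extensive (_ , _ , member a , member b , ↭-refl))))
    (cl-least (Provers-closed _) λ (_ , _ , Γ∈A , Δ∈B , ↭ΓΔ) →
      exchange (↭-sym ↭ΓΔ) (⊢⊗ (proves a Γ∈A) (proves b Δ∈B)))
    where a = ⟦⟧-candidate A cs ; b = ⟦⟧-candidate B cs
  ⟦⟧-candidate (A & B) cs = candidate
    (λ {Γ} Γ∈ → closed a (Closure-mono proj₁ {Γ} Γ∈)
              , closed b (Closure-mono proj₂ {Γ} Γ∈))
    ( closed a (λ _ _ h → &⊢₀ (h (member a)))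
    , closed b (λ _ _ h → &⊢₁ (h (member b))))
    (λ (Γ∈A , Γ∈B) → ⊢& (proves a Γ∈A) (proves b Γ∈B))
    where a = ⟦⟧-candidate A cs ; b = ⟦⟧-candidate B cs
  ⟦⟧-candidate (A ⊕ B) cs = candidate
    (cl-closed _)
    (cl-closed _ λ _ _ h → ⊕⊢ (h (cl-extensive (inj₁ (member a))))
                          (h (cl-extensive (inj₂ (member b)))))
    (cl-least (Provers-closed _) λ
      { (inj₁ Γ∈A) → ⊢⊕₀ (proves a Γ∈A)
      ; (inj₂ Γ∈B) → ⊢⊕₁ (proves b Γ∈B)
      })
    where a = ⟦⟧-candidate A cs ; b = ⟦⟧-candidate B cs
  ⟦⟧-candidate (A ⊸ B) cs = candidate
    (lower (⇒-closed _ _ (lift (closed b))))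
    (λ {Γ} Γ∈A → closed b λ Δ _ h → exchange
      (↭-trans (↭-sym (shift _ Γ Δ)) (↭-reflexive (sym (++-assoc Γ _ Δ))))
      (⊸⊢ (proves a Γ∈A) (h (member b))))
    (λ h → ⊢⊸ (proves b (h (member a))))
    where a = ⟦⟧-candidate A cs ; b = ⟦⟧-candidate B cs
  ⟦⟧-candidate (μ A p) {σ} {v} cs = candidate
    (lower (⋂-closed _ λ (lift (_ , c) , _) → lift (closed c)))
    (fromWitness {a? = em} λ X (lift (S , c) , A⊆X) →
      -- The first premise of `μ⊢` comes from the chain: the body at `S` lies in `⟦ A ⟧ (X • v)`,
      -- hence in `X`, hence proves `S`.
      closed c λ _ _ h → μ⊢ S
        (≡.subst (λ B → [ B ] ⊢ S) (sym (subst-exts-⟨⟩ σ S A))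
          (proves c (A⊆X (member (body c)))))
        (h (member c)))
    (λ Γ∈ → toWitness {a? = em} Γ∈ _
      -- `Provers M` is itself one of the intersected sets, by `⊢μ`.
      ( lift (M , Provers-candidate M)
      , λ {Γ} Γ∈A → ⊢μ (≡.subst (Γ ⊢_) (sym (subst-exts-⟨⟩ σ M A))
                          (proves (body (Provers-candidate M)) Γ∈A))))
    where
    M = subst σ (μ A p)
    body : ∀ {S X} → Candidate S X → Candidate (subst (S • σ) A) (⟦ A ⟧ (X • v))
    body c = ⟦⟧-candidate A (•-candidate c cs)
  ⟦⟧-candidate (ν A p) {σ} {v} cs = candidate
    (cl-closed _)
    (cl-extensive (fromWitness {a? = em}
      ( Closure (_≡ [ N ])
      , (lift (N , Closure-candidate N)
        -- The target is closed, so the inclusion is checked only at the generator `[ N ]`.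
        , λ {Γ} Γ∈ → closed n
            (Closure-mono {_≡ [ N ]} (λ { refl → N∈A }) {Γ} Γ∈))
      , member (Closure-candidate N))))
    (cl-least (Provers-closed N) (⋃-least λ X (lift (S , c) , X⊆A) Γ∈X →
      -- The invariant is the witness `S` of `X`: `[ S ]` lies in `X`, hence in `⟦ A ⟧ (X • v)`,
      -- hence proves the body at `S`.
      ⊢ν {p = positive-exts σ A p} S (proves c Γ∈X)
        (≡.subst ([ S ] ⊢_) (sym (subst-exts-⟨⟩ σ S A))
          (proves (body c) (X⊆A (member c))))))
    where
    N = subst σ (ν A p)
    body : ∀ {S X} → Candidate S X → Candidate (subst (S • σ) A) (⟦ A ⟧ (X • v))
    body c = ⟦⟧-candidate A (•-candidate c cs)
    n = body (Closure-candidate N)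
    N∈A : [ N ] ∈ ⟦ A ⟧ (Closure (_≡ [ N ]) • v)
    N∈A = closed n λ Δ C h →
      ν⊢ (≡.subst (λ B → B ∷ Δ ⊢ C) (sym (subst-exts-⟨⟩ σ N A)) (h (member n)))

  ⟦⟧V-candidate : ∀ A → Candidate (subst var A) (⟦ A ⟧ V)
  ⟦⟧V-candidate A = ⟦⟧-candidate A λ x → Provers-candidate (var x)

  admissible : Admissible
  admissible A = lift (subst var A , ⟦⟧V-candidate A)

lemma5p6 : (em : ExcludedMiddle (lsuc 0ℓ)) (A : Formula) →
    ((𝔐 : PhaseModel em) → PhaseModel.Admissible 𝔐 → PhaseModel.IsTrue 𝔐 A) →
    μIMALL⁻ ∣ [] ⊢ A
lemma5p6 em A A-true = ≡.subst ([] ⊢_) (subst-var (λ _ → refl) A)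
  (proves (⟦⟧V-candidate A) (A-true model admissible))
  where open Syntactic em
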